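{- There is a planar graph $G$ with $$3=\chi_{ad}(G)=\mathrm{ch}_{sep}(G)<\mathrm{ch}_{ad}(G)=\chi_{\nleftrightarrow}(G)=4.$$
   Context: Graphs are finite and simple. Given an edge coloring $f$ of $G$ (an arbitrary map from edges to colors, not necessarily proper), a vertex coloring $c$ (not necessarily proper) is adapted to $f$ if no edge $xy$ satisfies $c(x)=c(y)=f(xy)$. $\chi_{ad}(G)$ (adaptable chromatic number) is the smallest $k$ such that for every edge coloring $f$ of $G$ with colors $\{1,\dots,k\}$ there is a vertex coloring $c:V(G)\to\{1,\dots,k\}$ adapted to $f$. $\mathrm{ch}_{ad}(G)$ (adaptable choosability) is the smallest $k$ such that for every edge coloring $f$ and every assignment of lists $L(v)$ of $k$ colors to the vertices, there is a coloring $c$ adapted to $f$ with $c(v)\in L(v)$ for all $v$. $\mathrm{ch}_{sep}(G)$ (separation choosability) is the smallest $k$ such that for every assignment of lists $L(v)$ of $k$ colors to the vertices with $|L(x)\cap L(y)|\le 1$ for every edge $xy$, there is a proper coloring $\varphi$ of $G$ with $\varphi(v)\in L(v)$ for all $v$. A local $k$-partition of $G$ is a collection $\{c_v\}_{v\in V(G)}$ of maps $c_v : E(v)\to\{1,\dots,k\}$, where $E(v)$ is the set of edges incident with $v$. $G$ is conflict $\{c_v\}$-colorable if there is a map $\varphi : V(G)\to\{1,\dots,k\}$ such that no edge $e=xy$ satisfies both $\varphi(x)=c_x(e)$ and $\varphi(y)=c_y(e)$. $\chi_{\nleftrightarrow}(G)$ (single conflict chromatic number) is the smallest $k$ such that $G$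 is conflict $\{c_v\}$-colorable for every local $k$-partition. -}

module Defs where

open import Data.Fin using (Fin)
open import Data.List using (List; []; _∷_; _∷ʳ_; filter; length; reverse)
open import Data.List.Membership.Propositional using (_∈_)
open import Data.List.Relation.Unary.Unique.Propositional using (Unique)
open import Data.Nat using (ℕ; _≤_; _<_)
open import Data.Nat.Properties using (_≟_)
open import Data.List.Membership.DecPropositional _≟_ using (_∈?_)
open import Data.Product using (_×_; _,_; ∃-syntax)
open import Data.Rational using (ℚ; 0ℚ; 1ℚ) renaming (_+_ to _+ℚ_; _*_ to _*ℚ_; _-_ to _-ℚ_; _≤_ to _≤ℚ_)
open import Data.Sum using (_⊎_)
open import Data.Empty using (⊥)
open import Data.Unit using (⊤)
open import Function.Definitions using (Injective)
open import Relation.Binary.Definitions using (Decidable; Symmetric)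
open import Relation.Binary.PropositionalEquality using (_≡_; _≢_)
open import Relation.Nullary using (¬_)

record Graph : Set₁ where
  field
    order  : ℕ
  V : Set
  V = Fin order
  field
    Adj    : V → V → Set
    adj?   : Decidable Adj
    sym    : Symmetric Adj
    irrefl : ∀ {x} → ¬ Adj x x

open Graph public using (V; Adj)

-- k ranges over the positive integers.  With an empty palette there are no
-- edge colourings of a graph with an edge, and the properties below would
-- hold vacuously for k = 0.
record IsSmallest (P : ℕ → Set) (k : ℕ) : Set where
  field
    positive : 1 ≤ k
    holds    : P k
    minimal  : ∀ j → 1 ≤ j → j < k → ¬ P j

------------------------------------------------------------------------
-- Colourings

-- The edge xy has colour `colour x y`; values at non-adjacent pairs are junk
-- and never used.
record EdgeColouring (G : Graph) (C : Set) : Set where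
  field
    colour     : V G → V G → C
    consistent : ∀ {x y} → Adj G x y → colour x y ≡ colour y x

open EdgeColouring public using (colour)

Adapted : (G : Graph) {C : Set} → EdgeColouring G C → (V G → C) → Set
Adapted G f c = ∀ {x y} → Adj G x y → ¬ (c x ≡ c y × c y ≡ colour f x y)

Proper : (G : Graph) {C : Set} → (V G → C) → Set
Proper G φ = ∀ {x y} → Adj G x y → φ x ≢ φ y

-- Colours in lists are natural numbers.  A list of k colours is a k-element
-- set, represented by a repetition-free list of length k.
record ListAssignment (G : Graph) (k : ℕ) : Set where
  field
    list   : V G → List ℕ
    size   : ∀ v → length (list v) ≡ k
    unique : ∀ v → Unique (list v)

open ListAssignment public using (list)

From : (G : Graph) {k : ℕ} → ListAssignment G k → (V G → ℕ) → Set
From G L c = ∀ v → c v ∈ list L v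

_∩_ : List ℕ → List ℕ → List ℕ
xs ∩ ys = filter (_∈? ys) xs

Separated : (G : Graph) {k : ℕ} → ListAssignment G k → Set
Separated G L = ∀ {x y} → Adj G x y → length (list L x ∩ list L y) ≤ 1

-- `c x y` is the value c_x(xy); as above, values at non-adjacent pairs are
-- junk.  No relation between c x y and c y x is imposed.
LocalPartition : Graph → ℕ → Set
LocalPartition G k = V G → V G → Fin k

ConflictFree : (G : Graph) {k : ℕ} → LocalPartition G k → (V G → Fin k) → Set
ConflictFree G c φ = ∀ {x y} → Adj G x y → ¬ (φ x ≡ c x y × φ y ≡ c y x)

AdaptablyColourable : Graph → ℕ → Set
AdaptablyColourable G k =
  (f : EdgeColouring G (Fin k)) → ∃[ c ] Adapted G f c

AdaptablyChoosable : Graph → ℕ → Set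
AdaptablyChoosable G k =
  (f : EdgeColouring G ℕ) (L : ListAssignment G k) →
  ∃[ c ] (Adapted G f c × From G L c)

SeparationChoosable : Graph → ℕ → Set
SeparationChoosable G k =
  (L : ListAssignment G k) → Separated G L →
  ∃[ φ ] (Proper G φ × From G L φ)

ConflictColourable : Graph → ℕ → Set
ConflictColourable G k =
  (c : LocalPartition G k) → ∃[ φ ] ConflictFree G c φ

-- `χ-ad G ≐ k` etc. say that the parameter is defined and equal to k.
χ-ad_≐_ ch-ad_≐_ ch-sep_≐_ χ-conflict_≐_ : Graph → ℕ → Set
χ-ad       G ≐ k = IsSmallest (AdaptablyColourable G) k
ch-ad      G ≐ k = IsSmallest (AdaptablyChoosable G) k
ch-sep     G ≐ k = IsSmallest (SeparationChoosable G) k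
χ-conflict G ≐ k = IsSmallest (ConflictColourable G) k

------------------------------------------------------------------------
-- Planarity
--
-- A graph is planar if it can be drawn in the plane with edges as simple
-- polygonal arcs that meet only at common ends.  Vertices and bends may be
-- taken rational: a small perturbation of a polygonal drawing is again one.
-- Testing only rational points below loses nothing, since two segments with
-- rational ends meet in the empty set, a rational point, or a segment with
-- rational ends.

Point : Set
Point = ℚ × ℚ

infix 4 _∈[_,_] _on_

_∈[_,_] : Point → Point → Point → Set
(p₁ , p₂) ∈[ (a₁ , a₂) , (b₁ , b₂) ] =
  ∃[ t ] (0ℚ ≤ℚ t × t ≤ℚ 1ℚ ×
          p₁ ≡ a₁ +ℚ t *ℚ (b₁ -ℚ a₁) ×
          p₂ ≡ a₂ +ℚ t *ℚ (b₂ -ℚ a₂))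

_on_ : Point → List Point → Set
p on []           = ⊥
p on (a ∷ [])     = p ≡ a
p on (a ∷ b ∷ ps) = p ∈[ a , b ] ⊎ p on (b ∷ ps)

-- The polygonal path through the given points does not touch itself: each
-- segment is nondegenerate and meets the rest of the path only where the two
-- are joined.
Simple : List Point → Set
Simple []           = ⊤
Simple (a ∷ [])     = ⊤
Simple (a ∷ b ∷ ps) =
  a ≢ b ×
  (∀ p → p ∈[ a , b ] → p on (b ∷ ps) → p ≡ b) ×
  Simple (b ∷ ps)

_IsEndOf_-_ : {A : Set} → A → A → A → Set
w IsEndOf x - y = w ≡ x ⊎ w ≡ y

SameEdge : {A : Set} → A → A → A → A → Set
SameEdge x y u v = (x ≡ u × y ≡ v) ⊎ (x ≡ v × y ≡ u)

record PlaneDrawing (G : Graph) : Set where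
  field
    position : V G → Point
    -- interior corners of the arc from x to y; [] gives a straight edge
    bends    : V G → V G → List Point

  arc : V G → V G → List Point
  arc x y = position x ∷ (bends x y ∷ʳ position y)

  field
    position-injective : Injective _≡_ _≡_ position
    bends-reverse      : ∀ {x y} → Adj G x y → bends y x ≡ reverse (bends x y)
    arcs-simple        : ∀ {x y} → Adj G x y → Simple (arc x y)
    arcs-avoid         : ∀ {x y} → Adj G x y →
                         ∀ w → position w on arc x y → w IsEndOf x - y
    arcs-meet          : ∀ {x y u v} → Adj G x y → Adj G u v →
                         ¬ SameEdge x y u v →
                         ∀ p → p on arc x y → p on arc u v →
                         ∃[ w ] (p ≡ position w ×
                                 w IsEndOf x - y × w IsEndOf u - v)

Planar : Graph → Set
Planar G = PlaneDrawing G

{-# OPTIONS --safe #-}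

-- G is the join of two nonadjacent poles with nine disjoint edges, one edge
-- (block) for each pair (a , b).  Give the poles the lists {0,1,2} and {3,4,5}, the rim
-- vertices of block (a , b) the list {a, b, 6}, and colour the spokes a and b
-- and the link 6: whatever colours a and b the poles receive, both rim
-- vertices of block (a , b) are forced to 6.  So ch_ad > 3, and the single
-- conflict number bounds ch_ad from above.  Rim vertices have degree 3, which
-- gives conflict colourings with 4 colours, and G is 3-colourable.  In a
-- separated assignment of 3-lists the two ends of a link cannot both lose two
-- colours to the poles, so any colouring of the poles extends.
module Submission where

open import Defs
open import Data.Empty using (⊥; ⊥-elim)
open import Data.Fin using (Fin; zero; suc; toℕ; combine; cast; inject₁; opposite; _≟_)
open import Data.Fin.Patterns using (0F; 1F; 2F)
open import Data.Fin.Properties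
  using (+↔⊎; *↔×; toℕ-injective; combine-injective; all?; any?)
import Data.Fin.Properties as Fin
open import Data.List using (List; []; _∷_; drop; length; lookup)
open import Data.List.Membership.Propositional using (_∈_; _∉_; find)
open import Data.List.Membership.Propositional.Properties using (∈-lookup; ∈-filter⁺)
open import Data.List.Properties using (length-drop)
open import Data.List.Relation.Unary.All as All using (All; []; _∷_)
open import Data.List.Relation.Unary.All.Properties using (¬All⇒Any¬)
open import Data.List.Relation.Unary.AllPairs using ([]; _∷_)
open import Data.List.Relation.Unary.Any using (here; there; index)
open import Data.List.Relation.Unary.Any.Properties using (lookup-index)
open import Data.List.Relation.Unary.Unique.Propositional using (Unique)
open import Data.Nat as ℕ using (ℕ; zero; suc; s≤s; z≤n)
import Data.Nat.Properties as ℕ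
open import Data.List.Membership.DecPropositional ℕ._≟_ using (_∈?_)
open import Data.List.Relation.Unary.Unique.DecPropositional ℕ._≟_ using (unique?)
open import Data.Product using (Σ; _×_; _,_; proj₁; proj₂; ∃-syntax)
open import Data.Product.Function.NonDependent.Propositional using (_×-↔_)
open import Data.Product.Properties using (,-injectiveˡ; ,-injectiveʳ; ≡-dec)
open import Data.Rational
  using (ℚ; 0ℚ; 1ℚ; _+_; _*_; _-_; -_; _≤_; _<_; 1/_; NonZero; ≢-nonZero)
import Data.Rational.Properties as ℚ
open import Data.Rational.Solver using (module +-*-Solver)
open import Data.Sum using (_⊎_; inj₁; inj₂)
open import Data.Sum.Function.Propositional using (_⊎-↔_)
open import Function using (_∘_; _↔_; Inverse; case_of_)
open import Function.Construct.Composition using (_↔-∘_)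
open import Function.Construct.Identity using (↔-id)
open import Relation.Binary.Definitions using (tri<; tri≈; tri>)
open import Relation.Binary.PropositionalEquality
  using (_≡_; _≢_; refl; sym; trans; cong; cong₂; subst; subst₂; module ≡-Reasoning)
open import Relation.Nullary using (¬_; Dec; yes; no; ¬?; contradiction)
open import Relation.Nullary.Decidable using (from-yes; map′; _→-dec_; _×-dec_)

-- The graph

Block : Set
Block = Fin 3 × Fin 3

Vertex : Set
Vertex = Fin 2 ⊎ (Block × Fin 2)

pattern pole p  = inj₁ p
pattern rim j s = inj₂ (j , s)

infix 4 _~_

data _~_ : Vertex → Vertex → Set where
  spoke : ∀ {p j s} → pole p ~ rim j s
  spoke⁻ : ∀ {p j s} → rim j s ~ pole p
  link  : ∀ {j s t} → s ≢ t → rim j s ~ rim j t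

~-sym : ∀ {x y} → x ~ y → y ~ x
~-sym spoke      = spoke⁻
~-sym spoke⁻      = spoke
~-sym (link s≢t) = link (s≢t ∘ sym)

~-irrefl : ∀ {x} → ¬ x ~ x
~-irrefl (link s≢s) = s≢s refl

_≟ᴮ_ : (j k : Block) → Dec (j ≡ k)
_≟ᴮ_ = ≡-dec _≟_ _≟_

_~?_ : ∀ x y → Dec (x ~ y)
pole p  ~? pole q  = no λ ()
pole p  ~? rim j s = yes spoke
rim j s ~? pole p  = yes spoke⁻
rim j s ~? rim k t with j ≟ᴮ k
... | no j≢k   = no λ { (link _) → j≢k refl }
... | yes refl = map′ link (λ { (link s≢t) → s≢t }) (¬? (s ≟ t))

numbering : Fin 20 ↔ Vertex
numbering = (↔-id _ ⊎-↔ ((*↔× {3} {3} ×-↔ ↔-id _) ↔-∘ *↔× {9} {2})) ↔-∘ +↔⊎ {2} {18}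

-- Opaque, so that terms are compared without unfolding the bijection; the two inverse laws carry
-- all transfers between `Fin 20` and `Vertex`.
abstract
  decode : Fin 20 → Vertex
  decode = Inverse.to numbering

  encode : Vertex → Fin 20
  encode = Inverse.from numbering

  decode-encode : ∀ x → decode (encode x) ≡ x
  decode-encode = Inverse.strictlyInverseˡ numbering

  encode-decode : ∀ v → encode (decode v) ≡ v
  encode-decode = Inverse.strictlyInverseʳ numbering

decode-injective : ∀ {v w} → decode v ≡ decode w → v ≡ w
decode-injective {v} {w} e = trans (sym (encode-decode v)) (trans (cong encode e) (encode-decode w))

G : Graph
G = record
  { order  = 20
  ; Adj    = λ v w → decode v ~ decode w
  ; adj?   = λ v w → decode v ~? decode w
  ; sym    = ~-sym
  ; irrefl = ~-irrefl
  }

encode-adjacent : ∀ {x y} → x ~ y → Adj G (encode x) (encode y)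
encode-adjacent {x} {y} = subst₂ _~_ (sym (decode-encode x)) (sym (decode-encode y))

-- Planarity

*-cancelˡ-≢0 : ∀ {r x y} → r ≢ 0ℚ → r * x ≡ r * y → x ≡ y
*-cancelˡ-≢0 {r} {x} {y} r≢0 rx≡ry = begin
  x                ≡⟨ ℚ.*-identityˡ x ⟨
  1ℚ * x           ≡⟨ cong (_* x) (ℚ.*-inverseˡ r) ⟨
  (1/ r) * r * x   ≡⟨ ℚ.*-assoc (1/ r) r x ⟩
  (1/ r) * (r * x) ≡⟨ cong ((1/ r) *_) rx≡ry ⟩
  (1/ r) * (r * y) ≡⟨ ℚ.*-assoc (1/ r) r y ⟨
  (1/ r) * r * y   ≡⟨ cong (_* y) (ℚ.*-inverseˡ r) ⟩
  1ℚ * y           ≡⟨ ℚ.*-identityˡ y ⟩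
  y                ∎
  where
  open ≡-Reasoning
  instance
    r-nonZero : NonZero r
    r-nonZero = ≢-nonZero r≢0

+-cancelˡ-≡ : ∀ a {x y} → a + x ≡ a + y → x ≡ y
+-cancelˡ-≡ a {x} {y} e = trans (shift x) (trans (cong (- a +_) e) (sym (shift y)))
  where
  open +-*-Solver
  shift : ∀ z → z ≡ - a + (a + z)
  shift = solve 2 (λ a z → z := :- a :+ (a :+ z)) refl a

0≤1-t : ∀ {t} → t ≤ 1ℚ → 0ℚ ≤ 1ℚ - t
0≤1-t {t} t≤1 = subst (_≤ 1ℚ - t) (ℚ.+-inverseʳ t) (ℚ.+-monoˡ-≤ (- t) t≤1)

1-t≤1 : ∀ {t} → 0ℚ ≤ t → 1ℚ - t ≤ 1ℚ
1-t≤1 0≤t = ℚ.+-monoʳ-≤ 1ℚ (ℚ.neg-antimono-≤ 0≤t)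

≡-neg⇒≡0 : ∀ {r s} → 0ℚ ≤ r → 0ℚ ≤ s → r ≡ - s → r ≡ 0ℚ
≡-neg⇒≡0 0≤r 0≤s r≡-s = ℚ.≤-antisym (subst (_≤ 0ℚ) (sym r≡-s) (ℚ.neg-antimono-≤ 0≤s)) 0≤r

-- Block n has its two rim vertices at origin n and origin n + 1 on the x-axis.
origin : ℕ → ℚ
origin zero    = 0ℚ
origin (suc n) = (1ℚ + 1ℚ) + origin n

step≤ : ∀ n → origin n ≤ origin (suc n)
step≤ n = subst (_≤ origin (suc n)) (ℚ.+-identityˡ (origin n))
  (ℚ.+-monoˡ-≤ (origin n) (from-yes (0ℚ ℚ.≤? 1ℚ + 1ℚ)))

-- Consecutive origins differ by 2 while a block has width 1, so the base case is 1 < 2; later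
-- blocks only lie further right.
origin-gap : ∀ {m n} → m ℕ.< n → 1ℚ + origin m < origin n
origin-gap {m} m<n = gap (ℕ.≤⇒≤′ m<n)
  where
  gap : ∀ {n} → suc m ℕ.≤′ n → 1ℚ + origin m < origin n
  gap ℕ.≤′-refl      = ℚ.+-monoˡ-< (origin m) (from-yes (1ℚ ℚ.<? 1ℚ + 1ℚ))
  gap (ℕ.≤′-step {n} m<n) = ℚ.<-≤-trans (gap m<n) (step≤ n)

origin-disjoint : ∀ {m n s t} → s ≤ 1ℚ → 0ℚ ≤ t → s + origin m ≡ t + origin n → ¬ m ℕ.< n
origin-disjoint {m} {n} {s} {t} s≤1 0≤t e m<n = ℚ.<-irrefl e (begin-strict
  s + origin m  ≤⟨ ℚ.+-monoˡ-≤ (origin m) s≤1 ⟩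
  1ℚ + origin m <⟨ origin-gap m<n ⟩
  origin n      ≡⟨ ℚ.+-identityˡ (origin n) ⟨
  0ℚ + origin n ≤⟨ ℚ.+-monoˡ-≤ (origin n) 0≤t ⟩
  t + origin n  ∎)
  where open ℚ.≤-Reasoning

left : Block → ℚ
left (a , b) = origin (toℕ (combine a b))

Unit : ℚ → Set
Unit t = 0ℚ ≤ t × t ≤ 1ℚ

-- A strict order between the block numbers contradicts the gap between blocks, and `combine` is
-- injective. Applied to rim offsets and to positions along a link, this recovers the block from a
-- point of the x-axis.
left-disjoint : ∀ {j k s t} → Unit s → Unit t → s + left j ≡ t + left k → j ≡ k
left-disjoint {a , b} {c , d} (0≤s , s≤1) (0≤t , t≤1) e
  with ℕ.<-cmp (toℕ (combine a b)) (toℕ (combine c d))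
... | tri< m<n _ _ = contradiction m<n (origin-disjoint s≤1 0≤t e)
... | tri> _ _ n<m = contradiction n<m (origin-disjoint t≤1 0≤s (sym e))
... | tri≈ _ m≡n _ with refl , refl ← combine-injective a b c d (toℕ-injective m≡n) = refl

offset : Fin 2 → ℚ
offset 0F = 0ℚ
offset 1F = 1ℚ

offset-unit : ∀ s → Unit (offset s)
offset-unit 0F = from-yes (0ℚ ℚ.≤? 0ℚ) , from-yes (0ℚ ℚ.≤? 1ℚ)
offset-unit 1F = from-yes (0ℚ ℚ.≤? 1ℚ) , from-yes (1ℚ ℚ.≤? 1ℚ)

offset-injective : ∀ s t → offset s ≡ offset t → s ≡ t
offset-injective 0F 0F _ = refl
offset-injective 0F 1F ()
offset-injective 1F 0F ()
offset-injective 1F 1F _ = refl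

abscissa : Block → Fin 2 → ℚ
abscissa j s = offset s + left j

abscissa-injective : ∀ {j s k t} → abscissa j s ≡ abscissa k t → (j , s) ≡ (k , t)
abscissa-injective {j} {s} {k} {t} e
  with refl ← left-disjoint {j} {k} (offset-unit s) (offset-unit t) e =
  cong (j ,_) (offset-injective s t (+-cancelˡ-≡ (left j)
    (trans (ℚ.+-comm (left j) _) (trans e (ℚ.+-comm _ (left j))))))

-- The signed height at distance r above or below the x-axis.
height : Fin 2 → ℚ → ℚ
height 0F r = r
height 1F r = - r

height-injective : ∀ p {r s} → height p r ≡ height p s → r ≡ s
height-injective 0F e = e
height-injective 1F e = ℚ.neg-injective e

height-zero : ∀ p → height p 0ℚ ≡ 0ℚ
height-zero 0F = refl
height-zero 1F = refl

height≡0 : ∀ p {r} → height p r ≡ 0ℚ → r ≡ 0ℚ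
height≡0 p e = height-injective p (trans e (sym (height-zero p)))

-- One height is nonnegative and the other nonpositive, so they can agree only at 0.
height-opposite : ∀ {p q r s} → p ≢ q → 0ℚ ≤ r → 0ℚ ≤ s → height p r ≡ height q s → r ≡ 0ℚ
height-opposite {0F} {0F} p≢q _ _ _ = contradiction refl p≢q
height-opposite {0F} {1F} _ 0≤r 0≤s e = ≡-neg⇒≡0 0≤r 0≤s e
height-opposite {1F} {0F} _ 0≤r 0≤s e = ≡-neg⇒≡0 0≤r 0≤s (ℚ.neg-injective (trans e (sym (neg-involutive _))))
  where
  neg-involutive : ∀ s → - - s ≡ s
  neg-involutive = solve 1 (λ s → :- (:- s) := s) refl
    where open +-*-Solver
height-opposite {1F} {1F} p≢q _ _ _ = contradiction refl p≢q

-- Positions of the vertices and intersections of the edges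

place : Vertex → Point
place (pole p)  = 0ℚ , height p 1ℚ
place (rim j s) = abscissa j s , 0ℚ

place-injective : ∀ x y → place x ≡ place y → x ≡ y
place-injective (pole 0F) (pole 0F) _ = refl
place-injective (pole 0F) (pole 1F) e = case ,-injectiveʳ e of λ ()
place-injective (pole 1F) (pole 0F) e = case ,-injectiveʳ e of λ ()
place-injective (pole 1F) (pole 1F) _ = refl
place-injective (pole p)  (rim j s) e = contradiction (height≡0 p (,-injectiveʳ e)) λ ()
place-injective (rim j s) (pole p)  e = contradiction (height≡0 p (sym (,-injectiveʳ e))) λ ()
place-injective (rim j s) (rim k t) e = cong inj₂ (abscissa-injective {j} {s} {k} {t} (,-injectiveˡ e))

-- Edges without direction, so that intersections are analysed once and not for both directions of
-- each arc.
data Edge : Set where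
  spoke : Fin 2 → Block → Fin 2 → Edge
  link  : Block → Edge

EndOf : Edge → Vertex → Set
EndOf (spoke p j s) x = x ≡ pole p ⊎ x ≡ rim j s
EndOf (link j)      x = ∃[ s ] x ≡ rim j s

-- A spoke is parametrised by the distance r from the x-axis; it is harmless
-- to prolong it beyond the pole, to all r ≥ 0.
OnEdge : Edge → Point → Set
OnEdge (spoke p j s) (x , y) = ∃[ r ] (0ℚ ≤ r × x ≡ (1ℚ - r) * abscissa j s × y ≡ height p r)
OnEdge (link j)      (x , y) = ∃[ t ] (Unit t × x ≡ t + left j × y ≡ 0ℚ)

CommonEnd : Edge → Edge → Point → Set
CommonEnd e e′ pt = ∃[ w ] (pt ≡ place w × EndOf e w × EndOf e′ w)

CommonEnd-sym : ∀ {e e′ pt} → CommonEnd e e′ pt → CommonEnd e′ e pt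
CommonEnd-sym (w , pt≡w , w∈e , w∈e′) = w , pt≡w , w∈e′ , w∈e

rim-point : ∀ p j s {x y r} → r ≡ 0ℚ → x ≡ (1ℚ - r) * abscissa j s → y ≡ height p r →
            (x , y) ≡ place (rim j s)
rim-point p j s refl x≡ y≡ = cong₂ _,_ (trans x≡ (ℚ.*-identityˡ _)) (trans y≡ (height-zero p))

-- On opposite sides of the axis two spokes can share only a rim end. On the same side equal heights
-- give equal `r`, and there both abscissae are scaled by `1ℚ - r`.
spokes-meet : ∀ p j s q k t {pt} → OnEdge (spoke p j s) pt → OnEdge (spoke q k t) pt →
              spoke p j s ≡ spoke q k t ⊎ CommonEnd (spoke p j s) (spoke q k t) pt
spokes-meet p j s q k t (r , 0≤r , x≡ , y≡) (r′ , 0≤r′ , x≡′ , y≡′) with p ≟ q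
... | no p≢q = inj₂ (rim j s , at-rim , inj₂ refl , inj₂ (place-injective (rim j s) (rim k t)
                 (trans (sym at-rim) (rim-point q k t r′≡0 x≡′ y≡′))))
  where
  heights : height p r ≡ height q r′
  heights = trans (sym y≡) y≡′
  r′≡0 : r′ ≡ 0ℚ
  r′≡0 = height-opposite (p≢q ∘ sym) 0≤r′ 0≤r (sym heights)
  at-rim = rim-point p j s (height-opposite p≢q 0≤r 0≤r′ heights) x≡ y≡
... | yes refl with refl ← height-injective p {r} {r′} (trans (sym y≡) y≡′)
               | 1ℚ - r ℚ.≟ 0ℚ
-- A nonzero scale factor cancels, so the rim ends coincide; this covers the negative factors beyond
-- the pole too.
...   | no 1-r≢0 with refl ← abscissa-injective {j} {s} {k} {t} (*-cancelˡ-≢0 1-r≢0 (trans (sym x≡) x≡′)) =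
  inj₁ refl
-- The factor vanishes exactly at the height of the pole.
...   | yes 1-r≡0 = inj₂ (pole p , cong₂ _,_ x≡0 (trans y≡ (cong (height p) r≡1)) , inj₁ refl , inj₁ refl)
  where
  x≡0 = trans x≡ (trans (cong (_* abscissa j s) 1-r≡0) (ℚ.*-zeroˡ (abscissa j s)))
  r≡1 : r ≡ 1ℚ
  r≡1 = trans (solve 1 (λ r → r := con 1ℚ :- (con 1ℚ :- r)) refl r) (cong (λ q → 1ℚ - q) 1-r≡0)
    where open +-*-Solver

-- The link lies on the axis, so the spoke is met at its rim end, and `left-disjoint` puts that end
-- in the block of the link.
spoke-meets-link : ∀ p j s k {pt} → OnEdge (spoke p j s) pt → OnEdge (link k) pt →
                   CommonEnd (spoke p j s) (link k) pt
spoke-meets-link p j s k (r , _ , x≡ , y≡) (t , t∈ , x≡′ , y≡′) =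
  rim j s , at-rim , inj₂ refl , s , cong (λ j → rim j s) (left-disjoint {j} {k} (offset-unit s) t∈
    (trans (sym (,-injectiveˡ at-rim)) x≡′))
  where
  at-rim = rim-point p j s (height≡0 p (trans (sym y≡) y≡′)) x≡ y≡

edges-meet : ∀ e e′ {pt} → OnEdge e pt → OnEdge e′ pt → e ≡ e′ ⊎ CommonEnd e e′ pt
edges-meet (spoke p j s) (spoke q k t) h h′ = spokes-meet p j s q k t h h′
edges-meet (spoke p j s) (link k)      h h′ = inj₂ (spoke-meets-link p j s k h h′)
edges-meet (link j)      (spoke q k t) h h′ =
  inj₂ (CommonEnd-sym {spoke q k t} {link j} (spoke-meets-link q k t j h′ h))
edges-meet (link j)      (link k) (_ , s∈ , x≡ , _) (_ , t∈ , x≡′ , _) =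
  inj₁ (cong link (left-disjoint {j} {k} s∈ t∈ (trans (sym x≡) x≡′)))

edge : ∀ {x y} → x ~ y → Edge
edge (spoke {p} {j} {s}) = spoke p j s
edge (spoke⁻ {p} {j} {s}) = spoke p j s
edge (link {j} _)        = link j

endOf-edge : ∀ {x y} (a : x ~ y) {w} → EndOf (edge a) w → w IsEndOf x - y
endOf-edge spoke (inj₁ e) = inj₁ e
endOf-edge spoke (inj₂ e) = inj₂ e
endOf-edge spoke⁻ (inj₁ e) = inj₂ e
endOf-edge spoke⁻ (inj₂ e) = inj₁ e
endOf-edge (link {j} {s} {t} s≢t) (r , refl) with r ≟ s | r ≟ t
... | yes refl | _        = inj₁ refl
... | no _     | yes refl = inj₂ refl
... | no r≢s   | no r≢t   = ⊥-elim (third r s t r≢s r≢t s≢t)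
  where
  third : ∀ (r s t : Fin 2) → r ≢ s → r ≢ t → s ≢ t → ⊥
  third 0F 0F _  r≢s _   _   = r≢s refl
  third 0F 1F 0F _   r≢t _   = r≢t refl
  third 0F 1F 1F _   _   s≢t = s≢t refl
  third 1F 1F _  r≢s _   _   = r≢s refl
  third 1F 0F 1F _   r≢t _   = r≢t refl
  third 1F 0F 0F _   _   s≢t = s≢t refl

edge-end : ∀ {x y} (a : x ~ y) {w} → w IsEndOf x - y → EndOf (edge a) w
edge-end spoke (inj₁ e) = inj₁ e
edge-end spoke (inj₂ e) = inj₂ e
edge-end spoke⁻ (inj₁ e) = inj₂ e
edge-end spoke⁻ (inj₂ e) = inj₁ e
edge-end (link {s = s} _) (inj₁ e) = s , e
edge-end (link {t = t} _) (inj₂ e) = t , e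

sameEdge : ∀ {x y u v} (a : x ~ y) (b : u ~ v) → edge a ≡ edge b → SameEdge x y u v
sameEdge a b e = both a (end-in (inj₁ refl)) (end-in (inj₂ refl))
  where
  end-in : ∀ {w} → w IsEndOf _ - _ → w IsEndOf _ - _
  end-in w∈a = endOf-edge b (subst (λ e → EndOf e _) e (edge-end a w∈a))
  both : ∀ {x y u v} → x ~ y → x IsEndOf u - v → y IsEndOf u - v → SameEdge x y u v
  both a (inj₁ refl) (inj₁ refl) = ⊥-elim (~-irrefl a)
  both a (inj₁ p) (inj₂ q) = inj₁ (p , q)
  both a (inj₂ p) (inj₁ q) = inj₂ (p , q)
  both a (inj₂ refl) (inj₂ refl) = ⊥-elim (~-irrefl a)

-- Straight segments and the plane drawing

flat : ∀ t → 0ℚ + t * (0ℚ - 0ℚ) ≡ 0ℚ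
flat = solve 1 (λ t → con 0ℚ :+ t :* (con 0ℚ :- con 0ℚ) := con 0ℚ) refl
  where open +-*-Solver

-- The parameter `t` runs from the first vertex to the second, so the distance from the axis is
-- `1ℚ - t` when starting at the pole and `t` when starting on the rim. A link starting at its right
-- end is likewise reversed.
segment⇒edge : ∀ {x y} (a : x ~ y) pt → pt ∈[ place x , place y ] → OnEdge (edge a) pt
segment⇒edge (spoke {p} {j} {s}) _ (t , 0≤t , t≤1 , refl , refl) =
  1ℚ - t , 0≤1-t t≤1 , along t (abscissa j s) , upright p t
  where
  open +-*-Solver
  along : ∀ t x → 0ℚ + t * (x - 0ℚ) ≡ (1ℚ - (1ℚ - t)) * x
  along = solve 2 (λ t x → con 0ℚ :+ t :* (x :- con 0ℚ) := (con 1ℚ :- (con 1ℚ :- t)) :* x) refl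
  upright : ∀ p t → height p 1ℚ + t * (0ℚ - height p 1ℚ) ≡ height p (1ℚ - t)
  upright 0F = solve 1 (λ t → con 1ℚ :+ t :* (con 0ℚ :- con 1ℚ) := con 1ℚ :- t) refl
  upright 1F = solve 1 (λ t → (:- con 1ℚ) :+ t :* (con 0ℚ :- (:- con 1ℚ)) := :- (con 1ℚ :- t)) refl
segment⇒edge (spoke⁻ {p} {j} {s}) _ (t , 0≤t , t≤1 , refl , refl) =
  t , 0≤t , along t (abscissa j s) , upright p t
  where
  open +-*-Solver
  along : ∀ t x → x + t * (0ℚ - x) ≡ (1ℚ - t) * x
  along = solve 2 (λ t x → x :+ t :* (con 0ℚ :- x) := (con 1ℚ :- t) :* x) refl
  upright : ∀ p t → 0ℚ + t * (height p 1ℚ - 0ℚ) ≡ height p t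
  upright 0F = solve 1 (λ t → con 0ℚ :+ t :* (con 1ℚ :- con 0ℚ) := t) refl
  upright 1F = solve 1 (λ t → con 0ℚ :+ t :* ((:- con 1ℚ) :- con 0ℚ) := :- t) refl
segment⇒edge (link {j} {s} {r} s≢r) _ (t , 0≤t , t≤1 , refl , refl) with s | r
... | 0F | 0F = contradiction refl s≢r
... | 1F | 1F = contradiction refl s≢r
... | 0F | 1F = t , (0≤t , t≤1) , along t (left j) , flat t
  where
  open +-*-Solver
  along : ∀ t x → 0ℚ + x + t * (1ℚ + x - (0ℚ + x)) ≡ t + x
  along = solve 2 (λ t x → con 0ℚ :+ x :+ t :* (con 1ℚ :+ x :- (con 0ℚ :+ x)) := t :+ x) refl
... | 1F | 0F = 1ℚ - t , (0≤1-t t≤1 , 1-t≤1 0≤t) , along t (left j) , flat t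
  where
  open +-*-Solver
  along : ∀ t x → 1ℚ + x + t * (0ℚ + x - (1ℚ + x)) ≡ 1ℚ - t + x
  along = solve 2 (λ t x → con 1ℚ :+ x :+ t :* (con 0ℚ :+ x :- (con 1ℚ :+ x)) := con 1ℚ :- t :+ x) refl

incident : ∀ x → ∃[ y ] x ~ y
incident (pole p)  = rim (0F , 0F) 0F , spoke
incident (rim j s) = pole 0F , spoke⁻

arcs-meet : ∀ {x y u v} → x ~ y → u ~ v → ∀ pt →
            pt ∈[ place x , place y ] → pt ∈[ place u , place v ] →
            SameEdge x y u v ⊎ ∃[ w ] (pt ≡ place w × w IsEndOf x - y × w IsEndOf u - v)
arcs-meet a b pt h h′ with edges-meet (edge a) (edge b) (segment⇒edge a pt h) (segment⇒edge b pt h′)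
... | inj₁ same = inj₁ (sameEdge a b same)
... | inj₂ (w , pt≡w , w∈a , w∈b) =
  inj₂ (w , pt≡w , endOf-edge a w∈a , endOf-edge b w∈b)

start-on-segment : ∀ a b → a ∈[ a , b ]
start-on-segment (a₁ , a₂) (b₁ , b₂) =
  0ℚ , from-yes (0ℚ ℚ.≤? 0ℚ) , from-yes (0ℚ ℚ.≤? 1ℚ) , still a₁ b₁ , still a₂ b₂
  where
  open +-*-Solver
  still : ∀ a b → a ≡ a + 0ℚ * (b - a)
  still = solve 2 (λ a b → a := a :+ con 0ℚ :* (b :- a)) refl

end-on-segment : ∀ a b → b ∈[ a , b ]
end-on-segment (a₁ , a₂) (b₁ , b₂) =
  1ℚ , from-yes (0ℚ ℚ.≤? 1ℚ) , from-yes (1ℚ ℚ.≤? 1ℚ) , full a₁ b₁ , full a₂ b₂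
  where
  open +-*-Solver
  full : ∀ a b → b ≡ a + 1ℚ * (b - a)
  full = solve 2 (λ a b → b := a :+ con 1ℚ :* (b :- a)) refl

straight : ∀ a b {pt} → pt on (a ∷ b ∷ []) → pt ∈[ a , b ]
straight _ _ (inj₁ h)    = h
straight a b (inj₂ refl) = end-on-segment a b

-- A vertex on an arc also starts some edge of its own, supplied by `incident`. By `arcs-meet` the
-- two edges coincide or the point is a common end; either way the vertex is an end of the arc.
arcs-avoid : ∀ {x y} → x ~ y → ∀ w → place w ∈[ place x , place y ] → w IsEndOf x - y
arcs-avoid {x} {y} a w h = shared (arcs-meet a b (place w) h (start-on-segment (place w) (place z)))
  where
  z = proj₁ (incident w)
  b = proj₂ (incident w)
  shared : SameEdge x y w z ⊎ ∃[ w′ ] (place w ≡ place w′ × w′ IsEndOf x - y × w′ IsEndOf w - z) →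
           w IsEndOf x - y
  shared (inj₁ (inj₁ (x≡w , _))) = inj₁ (sym x≡w)
  shared (inj₁ (inj₂ (_ , y≡w))) = inj₂ (sym y≡w)
  shared (inj₂ (w′ , w≡w′ , w′∈a , _)) =
    subst (_IsEndOf x - y) (sym (place-injective w w′ w≡w′)) w′∈a

IsEndOf-decode : ∀ {w x y} → decode w IsEndOf decode x - decode y → w IsEndOf x - y
IsEndOf-decode (inj₁ e) = inj₁ (decode-injective e)
IsEndOf-decode (inj₂ e) = inj₂ (decode-injective e)

SameEdge-decode : ∀ {x y u v} → SameEdge (decode x) (decode y) (decode u) (decode v) → SameEdge x y u v
SameEdge-decode (inj₁ (e , e′)) = inj₁ (decode-injective e , decode-injective e′)
SameEdge-decode (inj₂ (e , e′)) = inj₂ (decode-injective e , decode-injective e′)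

planar : Planar G
planar = record
  { position           = place ∘ decode
  ; bends              = λ _ _ → []
  ; position-injective = decode-injective ∘ place-injective _ _
  ; bends-reverse      = λ _ → refl
  -- A straight arc has one segment, after which only its last point is left, so membership in the
  -- remainder is itself the required equation.
  ; arcs-simple        = λ a → (λ e → ~-irrefl (subst (_~ _) (place-injective _ _ e) a)) , (λ _ _ e → e) , _
  ; arcs-avoid         = λ {x} {y} a w h → IsEndOf-decode {w} {x} {y} (arcs-avoid a (decode w) (straight (place (decode x)) (place (decode y)) h))
  ; arcs-meet          = meet
  }
  where
  meet : ∀ {x y u v} → Adj G x y → Adj G u v → ¬ SameEdge x y u v → ∀ pt →
         pt on (place (decode x) ∷ place (decode y) ∷ []) →
         pt on (place (decode u) ∷ place (decode v) ∷ []) →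
         ∃[ w ] (pt ≡ place (decode w) × w IsEndOf x - y × w IsEndOf u - v)
  meet {x} {y} {u} {v} a b distinct pt h h′ = shared (arcs-meet a b pt
      (straight (place (decode x)) (place (decode y)) h) (straight (place (decode u)) (place (decode v)) h′))
    where
    shared : SameEdge (decode x) (decode y) (decode u) (decode v) ⊎
             ∃[ w ] (pt ≡ place w × w IsEndOf decode x - decode y × w IsEndOf decode u - decode v) →
             ∃[ w ] (pt ≡ place (decode w) × w IsEndOf x - y × w IsEndOf u - v)
    shared (inj₁ same) = contradiction (SameEdge-decode {x} {y} {u} {v} same) distinct
    shared (inj₂ (w , pt≡w , w∈a , w∈b)) =
      encode w , trans pt≡w (cong place (sym (decode-encode w))) , inEnds x y w∈a , inEnds u v w∈b
      where
      inEnds : ∀ x y → w IsEndOf decode x - decode y → encode w IsEndOf x - y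
      inEnds x y = IsEndOf-decode {_} {x} {y} ∘ subst (_IsEndOf _ - _) (sym (decode-encode w))

-- Choosing from lists

lookup-injective : ∀ {A : Set} {xs : List A} → Unique xs → ∀ {i j} → lookup xs i ≡ lookup xs j → i ≡ j
lookup-injective (x∉xs ∷ xs!) {zero}  {zero}  _ = refl
lookup-injective (x∉xs ∷ xs!) {zero}  {suc j} e = contradiction e (All.lookup x∉xs (∈-lookup j))
lookup-injective (x∉xs ∷ xs!) {suc i} {zero}  e = contradiction (sym e) (All.lookup x∉xs (∈-lookup i))
lookup-injective (x∉xs ∷ xs!) {suc i} {suc j} e = cong suc (lookup-injective xs! e)

-- Pigeonhole: the position in `ys` of an entry of `xs` is an injective function of its position in
-- `xs`.
unique-⊆⇒length≤ : ∀ {A : Set} {xs ys : List A} → Unique xs → All (_∈ ys) xs → length xs ℕ.≤ length ys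
unique-⊆⇒length≤ {xs = xs} {ys} xs! xs⊆ys = Fin.injective⇒≤ {f = λ i → index (xs∈ys i)} λ {i} {j} e →
  lookup-injective xs! (trans (lookup-index (xs∈ys i)) (trans (cong (lookup ys) e) (sym (lookup-index (xs∈ys j)))))
  where
  xs∈ys : ∀ i → lookup xs i ∈ ys
  xs∈ys i = All.lookup xs⊆ys (∈-lookup i)

fresh : ∀ {xs} ys → Unique xs → length ys ℕ.< length xs → ∃[ x ] (x ∈ xs × x ∉ ys)
fresh {xs} ys xs! ys<xs = find (¬All⇒Any¬ (_∈? ys) xs λ xs⊆ys → ℕ.<⇒≱ ys<xs (unique-⊆⇒length≤ xs! xs⊆ys))

-- Adaptable choosability

-- Positions in the list of `v` serve as the colours at `v`. Reading each edge colour, at either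
-- end, as its position in that end's list gives a local partition.
conflict⇒choosable : ∀ {H k} → ConflictColourable H (suc k) → AdaptablyChoosable H (suc k)
conflict⇒choosable {H} {k} conflict f L = (λ v → pick v (φ v)) , adapted , λ v → ∈-lookup (position v (φ v))
  where
  module L = ListAssignment L

  position : ∀ v → Fin (suc k) → Fin (length (L.list v))
  position v = cast (sym (L.size v))

  pick : V H → Fin (suc k) → ℕ
  pick v i = lookup (L.list v) (position v i)

  pick-injective : ∀ v {i j} → pick v i ≡ pick v j → i ≡ j
  pick-injective v {i} {j} e = toℕ-injective (trans (sym (Fin.toℕ-cast _ i))
    (trans (cong toℕ (lookup-injective (L.unique v) e)) (Fin.toℕ-cast _ j)))

  code : V H → ℕ → Fin (suc k)
  code v c with any? (λ i → pick v i ℕ.≟ c)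
  ... | yes (i , _) = i
  -- A colour missing from the list cannot cause a violation at `v`, so the default only adds a
  -- constraint. It exists because the palette is `suc k`.
  ... | no  _       = zero

  code-pick : ∀ v i → code v (pick v i) ≡ i
  code-pick v i with any? (λ j → pick v j ℕ.≟ pick v i)
  ... | yes (j , e) = pick-injective v e
  ... | no  absent  = contradiction (i , refl) absent

  conflicts : LocalPartition H (suc k)
  conflicts x y = code x (colour f x y)

  φ = proj₁ (conflict conflicts)

  adapted : Adapted H f (λ v → pick v (φ v))
  -- A violation makes both vertex colours equal to the edge colour, whose codes at the two ends are
  -- then `φ x` and `φ y`: a conflict.
  adapted {x} {y} xy (cx≡cy , cy≡f) = proj₂ (conflict conflicts) xy
    ( trans (sym (code-pick x (φ x))) (cong (code x) (trans cx≡cy cy≡f))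
    , trans (sym (code-pick y (φ y))) (cong (code y) (trans cy≡f (EdgeColouring.consistent f xy))) )

-- Discard the first colour of every list and choose from the rest.
choosable-suc : ∀ {H k} → AdaptablyChoosable H k → AdaptablyChoosable H (suc k)
choosable-suc {H} {k} choosable f L = c , adapted , λ v → ⊆ v (from v)
  where
  module L = ListAssignment L

  ⊆ : ∀ v {n} → n ∈ drop 1 (L.list v) → n ∈ L.list v
  ⊆ v n∈ with _ ∷ _ ← L.list v = there n∈

  unique-drop : ∀ {xs : List ℕ} → Unique xs → Unique (drop 1 xs)
  unique-drop []       = []
  unique-drop (_ ∷ xs!) = xs!

  shorter : ListAssignment H k
  shorter = record
    { list   = λ v → drop 1 (L.list v)
    ; size   = λ v → trans (length-drop 1 (L.list v)) (cong (ℕ._∸ 1) (L.size v))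
    ; unique = λ v → unique-drop (L.unique v)
    }

  c       = proj₁ (choosable f shorter)
  adapted = proj₁ (proj₂ (choosable f shorter))
  from    = proj₂ (proj₂ (choosable f shorter))

choosable-mono : ∀ {H j k} → j ℕ.≤′ k → AdaptablyChoosable H j → AdaptablyChoosable H k
choosable-mono ℕ.≤′-refl       choosable = choosable
choosable-mono (ℕ.≤′-step j≤k) choosable = choosable-suc (choosable-mono j≤k choosable)

-- Upper bounds

-- A proper colouring is adapted to every edge colouring.
colourable₃ : AdaptablyColourable G 3
colourable₃ f = shade ∘ decode , λ a (e , _) → proper a e
  where
  shade : Vertex → Fin 3
  shade (pole _)  = 0F
  shade (rim _ s) = suc s

  proper : ∀ {x y} → x ~ y → shade x ≢ shade y
  proper spoke      ()
  proper spoke⁻      ()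
  proper (link s≢t) e = s≢t (Fin.suc-injective e)

-- The poles get an arbitrary colour, and every conflict is avoided at a rim end, where two spokes
-- and a link exclude at most three of four colours.
conflictColourable₄ : ConflictColourable G 4
conflictColourable₄ c = φ ∘ decode , λ {v} {w} a (e , e′) → free a
    (trans e (sym (c-decode v w))) (trans e′ (sym (c-decode w v)))
  where
  κ : Vertex → Vertex → Fin 4
  κ x y = c (encode x) (encode y)

  c-decode : ∀ v w → κ (decode v) (decode w) ≡ c v w
  c-decode v w = cong₂ c (encode-decode v) (encode-decode w)

  fourth : ∀ p q r → ∃[ x ] (x ≢ p × x ≢ q × x ≢ r)
  fourth = from-yes (all? λ p → all? λ q → all? λ r → any? {n = 4} λ x →
    ¬? (x ≟ p) ×-dec ¬? (x ≟ q) ×-dec ¬? (x ≟ r))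

  -- The third value guards the link at the end `1F`. At the end `0F` it is the junk value of a
  -- nonadjacent pair, and excluding it is harmless.
  avoid : ∀ j s → ∃[ x ] (x ≢ κ (rim j s) (pole 0F) × x ≢ κ (rim j s) (pole 1F) × x ≢ κ (rim j s) (rim j 0F))
  avoid j s = fourth _ _ _

  φ : Vertex → Fin 4
  φ (pole _)  = 0F
  φ (rim j s) = proj₁ (avoid j s)

  spoke-free : ∀ p j s → φ (rim j s) ≢ κ (rim j s) (pole p)
  spoke-free 0F j s = proj₁ (proj₂ (avoid j s))
  spoke-free 1F j s = proj₁ (proj₂ (proj₂ (avoid j s)))

  link-free : ∀ j s → φ (rim j s) ≢ κ (rim j s) (rim j 0F)
  link-free j s = proj₂ (proj₂ (proj₂ (avoid j s)))

  free : ∀ {x y} → x ~ y → φ x ≡ κ x y → φ y ≢ κ y x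
  free (spoke {p} {j} {s}) _ e = spoke-free p j s e
  free (spoke⁻ {p} {j} {s}) e _ = spoke-free p j s e
  free (link {j} {s}  {0F} _) e _ = link-free j s e
  free (link {j} {0F} {t}  _) _ e = link-free j t e
  free (link {j} {1F} {1F} s≢s) _ _ = s≢s refl

-- Unless `a` and `b` are distinct and both present, at most one colour of `xs` is lost to them.
-- That colour is `d`: take `b` if `a` is absent, otherwise `a`.
pair-or-spare : ∀ xs a b → (a ≢ b × a ∈ xs × b ∈ xs) ⊎
                ∃[ d ] (∀ {x} → x ∈ xs → x ≢ d → x ∉ a ∷ b ∷ [])
pair-or-spare xs a b with a ℕ.≟ b | a ∈? xs | b ∈? xs
... | no a≢b   | yes a∈xs | yes b∈xs =
  inj₁ (a≢b , a∈xs , b∈xs)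
... | yes refl | _        | _        =
  inj₂ (a , λ _ x≢a → λ { (here x≡a) → x≢a x≡a ; (there (here x≡a)) → x≢a x≡a })
... | no _     | no a∉xs  | _        =
  inj₂ (b , λ x∈xs x≢b → λ { (here refl) → a∉xs x∈xs ; (there (here x≡b)) → x≢b x≡b })
... | no _     | yes _    | no b∉xs  =
  inj₂ (a , λ x∈xs x≢a → λ { (here x≡a) → x≢a x≡a ; (there (here refl)) → b∉xs x∈xs })

-- An extension to one block, whose ends have the lists `xs` and `ys`, once the poles have received
-- `a` and `b`.
record PairColouring (xs ys : List ℕ) (a b : ℕ) : Set where
  field
    x y  : ℕ
    x∈xs : x ∈ xs
    y∈ys : y ∈ ys
    x≢y  : x ≢ y
    x∉ab : x ∉ a ∷ b ∷ []
    y∉ab : y ∉ a ∷ b ∷ []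

PairColouring-sym : ∀ {xs ys a b} → PairColouring xs ys a b → PairColouring ys xs a b
PairColouring-sym c = record { x∈xs = y∈ys ; y∈ys = x∈xs ; x≢y = x≢y ∘ sym ; x∉ab = y∉ab ; y∉ab = x∉ab }
  where open PairColouring c

-- The order matters: `ys` goes first, with three colours against the two of the poles; then `xs`
-- has to avoid only `d` and the chosen `y`, again two out of three.
spare⇒pairColouring : ∀ {xs ys a b d} → Unique xs → Unique ys → length xs ≡ 3 → length ys ≡ 3 →
                      (∀ {x} → x ∈ xs → x ≢ d → x ∉ a ∷ b ∷ []) → PairColouring xs ys a b
spare⇒pairColouring {a = a} {b} {d} xs! ys! ∣xs∣≡3 ∣ys∣≡3 spare
  with y , y∈ys , y∉ab ← fresh (a ∷ b ∷ []) ys! (ℕ.≤-reflexive (sym ∣ys∣≡3))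
  with x , x∈xs , x∉dy ← fresh (d ∷ y ∷ []) xs! (ℕ.≤-reflexive (sym ∣xs∣≡3)) =
  record { x∈xs = x∈xs ; y∈ys = y∈ys ; x≢y = x∉dy ∘ there ∘ here
         ; x∉ab = spare x∈xs (x∉dy ∘ here) ; y∉ab = y∉ab }

-- Two colours lying in both lists would contradict separation, so one of the
-- lists loses at most one colour to a and b; its vertex is coloured last.
separated⇒pairColouring : ∀ {xs ys} a b → Unique xs → Unique ys → length xs ≡ 3 → length ys ≡ 3 →
                          length (xs ∩ ys) ℕ.≤ 1 → PairColouring xs ys a b
separated⇒pairColouring {xs} {ys} a b xs! ys! ∣xs∣≡3 ∣ys∣≡3 sep
  with pair-or-spare xs a b | pair-or-spare ys a b
... | inj₂ (_ , spare) | _ = spare⇒pairColouring xs! ys! ∣xs∣≡3 ∣ys∣≡3 spare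
... | inj₁ _ | inj₂ (_ , spare) = PairColouring-sym (spare⇒pairColouring ys! xs! ∣ys∣≡3 ∣xs∣≡3 spare)
... | inj₁ (a≢b , a∈xs , b∈xs) | inj₁ (_ , a∈ys , b∈ys) = contradiction
  (unique-⊆⇒length≤ ((a≢b ∷ []) ∷ [] ∷ [])
    (∈-filter⁺ (_∈? ys) a∈xs a∈ys ∷ ∈-filter⁺ (_∈? ys) b∈xs b∈ys ∷ []))
  (ℕ.<⇒≱ (s≤s sep))

separationChoosable₃ : SeparationChoosable G 3
separationChoosable₃ L sep = φ ∘ decode , (λ a → proper a) ,
  λ v → subst (λ w → φ (decode v) ∈ L.list w) (encode-decode v) (from (decode v))
  where
  module L = ListAssignment L
  open PairColouring

  colours : Vertex → List ℕ
  colours x = L.list (encode x)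

  poleColour : ∀ p → ∃[ x ] (x ∈ colours (pole p) × x ∉ [])
  -- With nothing to avoid, `fresh` picks any element of a nonempty list; the poles are nonadjacent.
  poleColour p = fresh [] (L.unique _) (subst (0 ℕ.<_) (sym (L.size (encode (pole p)))) (s≤s z≤n))

  hue : Fin 2 → ℕ
  hue p = proj₁ (poleColour p)

  pair : ∀ j → PairColouring (colours (rim j 0F)) (colours (rim j 1F)) (hue 0F) (hue 1F)
  pair j = separated⇒pairColouring (hue 0F) (hue 1F) (L.unique _) (L.unique _) (L.size _) (L.size _)
    (sep (encode-adjacent (link {j} {0F} {1F} λ ())))

  φ : Vertex → ℕ
  φ (pole p)   = hue p
  φ (rim j 0F) = x (pair j)
  φ (rim j 1F) = y (pair j)

  from : ∀ x → φ x ∈ colours x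
  from (pole p)   = proj₁ (proj₂ (poleColour p))
  from (rim j 0F) = x∈xs (pair j)
  from (rim j 1F) = y∈ys (pair j)

  avoids : ∀ j s → φ (rim j s) ∉ hue 0F ∷ hue 1F ∷ []
  avoids j 0F = x∉ab (pair j)
  avoids j 1F = y∉ab (pair j)

  spoke-proper : ∀ p j s → φ (rim j s) ≢ hue p
  spoke-proper 0F j s e = avoids j s (here e)
  spoke-proper 1F j s e = avoids j s (there (here e))

  proper : ∀ {x y} → x ~ y → φ x ≢ φ y
  proper (spoke {p} {j} {s}) = spoke-proper p j s ∘ sym
  proper (spoke⁻ {p} {j} {s}) = spoke-proper p j s
  proper (link {j} {0F} {1F} _) = x≢y (pair j)
  proper (link {j} {1F} {0F} _) = x≢y (pair j) ∘ sym
  proper (link {j} {0F} {0F} s≢s) = contradiction refl s≢s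
  proper (link {j} {1F} {1F} s≢s) = contradiction refl s≢s

-- Lower bounds

blockColour : {C : Set} → (Fin 2 → Block → C) → (Block → C) → Vertex → Vertex → C
-- A junk value for the nonadjacent poles; any element of `C` would do.
blockColour g ℓ (pole p)  (pole q)  = ℓ (0F , 0F)
blockColour g ℓ (pole p)  (rim j s) = g p j
blockColour g ℓ (rim j s) (pole p)  = g p j
blockColour g ℓ (rim j s) (rim k t) = ℓ j

blockColouring : {C : Set} → (Fin 2 → Block → C) → (Block → C) → EdgeColouring G C
blockColouring {C} g ℓ = record
  { colour     = λ v w → blockColour g ℓ (decode v) (decode w)
  ; consistent = symmetric
  }
  where
  symmetric : ∀ {x y} → x ~ y → blockColour g ℓ x y ≡ blockColour g ℓ y x
  symmetric spoke    = refl
  symmetric spoke⁻    = refl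
  symmetric (link _) = refl

-- In a block whose spokes carry the colours of their poles, no rim end may repeat a pole colour. If
-- this forces both ends to the link colour, the link is violated.
not-adapted : ∀ {C : Set} {g : Fin 2 → Block → C} {ℓ} {c} j → Adapted G (blockColouring g ℓ) c →
              (∀ p → c (encode (pole p)) ≡ g p j) →
              (∀ s → (∀ p → c (encode (rim j s)) ≢ g p j) → c (encode (rim j s)) ≡ ℓ j) → ⊥
not-adapted {g = g} {ℓ} {c} j adapted at-pole at-rim =
  adapted (encode-adjacent (link {j} {0F} {1F} λ ()))
    (trans (forced 0F) (sym (forced 1F)) , trans (forced 1F) (sym (colour-encode (rim j 0F) (rim j 1F))))
  where
  f = blockColouring g ℓ
  colour-encode : ∀ x y → colour f (encode x) (encode y) ≡ blockColour g ℓ x y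
  colour-encode x y = cong₂ (blockColour g ℓ) (decode-encode x) (decode-encode y)
  forced : ∀ s → c (encode (rim j s)) ≡ ℓ j
  forced s = at-rim s λ p e → adapted (encode-adjacent (spoke⁻ {p} {j} {s}))
    (trans e (sym (at-pole p)) , trans (at-pole p) (sym (colour-encode (rim j s) (pole p))))

coordinate : Fin 2 → Block → Fin 3
coordinate 0F = proj₁
coordinate 1F = proj₂

¬colourable₁ : ¬ AdaptablyColourable G 1
¬colourable₁ colourable with c , adapted ← colourable (blockColouring (λ _ _ → 0F) (λ _ → 0F)) =
  not-adapted (0F , 0F) adapted (λ _ → trivial _) (λ _ _ → trivial _)
  where
  trivial : ∀ (i : Fin 1) → i ≡ 0F
  trivial 0F = refl

¬colourable₂ : ¬ AdaptablyColourable G 2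
¬colourable₂ colourable =
  -- The block is picked once the colours of the poles are known.
  not-adapted (inject₁ (c (encode (pole 0F))) , inject₁ (c (encode (pole 1F)))) (proj₂ (colourable f))
    (λ { 0F → sym (clip-inject₁ _) ; 1F → sym (clip-inject₁ _) })
    -- With two colours, avoiding that of pole `0F` leaves its opposite, the colour given to the
    -- link.
    (λ s avoids → other-unique _ _ (avoids 0F))
  where
  -- Blocks have three indices per pole but the palette has two colours; `clip` is a retraction of
  -- `inject₁`.
  clip : Fin 3 → Fin 2
  clip 0F      = 0F
  clip (suc _) = 1F
  clip-inject₁ : ∀ i → clip (inject₁ i) ≡ i
  clip-inject₁ 0F = refl
  clip-inject₁ 1F = refl
  f : EdgeColouring G (Fin 2)
  f = blockColouring (λ p j → clip (coordinate p j)) (opposite ∘ clip ∘ proj₁)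
  c = proj₁ (colourable f)
  other-unique : ∀ x y → x ≢ y → x ≡ opposite y
  other-unique 0F 0F x≢x = contradiction refl x≢x
  other-unique 0F 1F _   = refl
  other-unique 1F 0F _   = refl
  other-unique 1F 1F x≢x = contradiction refl x≢x

-- The poles get disjoint colour sets below 6, so one tint of each together with 6 makes a list
-- without repetition.
tint : Fin 2 → Fin 3 → ℕ
tint 0F a = toℕ a
tint 1F b = 3 ℕ.+ toℕ b

tints : Fin 2 → Block → ℕ
tints p j = tint p (coordinate p j)

¬choosable₃ : ¬ AdaptablyChoosable G 3
¬choosable₃ choosable =
  let c , adapted , from = choosable (blockColouring tints (λ _ → 6)) L in refute c adapted from
  where
  colours : Vertex → List ℕ
  colours (pole p)  = tint p 0F ∷ tint p 1F ∷ tint p 2F ∷ []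
  colours (rim j _) = tints 0F j ∷ tints 1F j ∷ 6 ∷ []

  L : ListAssignment G 3
  L = record
    { list   = colours ∘ decode
    ; size   = size ∘ decode
    ; unique = unique ∘ decode
    }
    where
    size : ∀ x → length (colours x) ≡ 3
    size (pole _)  = refl
    size (rim _ _) = refl
    unique : ∀ x → Unique (colours x)
    unique (pole p)        = from-yes (all? λ p → unique? (colours (pole p))) p
    -- The list does not depend on `s`, so the check at the end `0F` covers both.
    unique (rim (a , b) s) = from-yes (all? λ a → all? λ b → unique? (colours (rim (a , b) 0F))) a b

  tint-of : ∀ {n} p → n ∈ colours (pole p) → ∃[ a ] n ≡ tint p a
  tint-of p (here e)                 = 0F , e
  tint-of p (there (here e))         = 1F , e
  tint-of p (there (there (here e))) = 2F , e

  remaining : ∀ {n} j s → n ∈ colours (rim j s) → (∀ p → n ≢ tints p j) → n ≡ 6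
  remaining j s (here e)                 avoids = contradiction e (avoids 0F)
  remaining j s (there (here e))         avoids = contradiction e (avoids 1F)
  remaining j s (there (there (here e))) _      = e

  refute : ∀ c → Adapted G (blockColouring tints (λ _ → 6)) c → From G L c → ⊥
  refute c adapted from = not-adapted (proj₁ (at 0F) , proj₁ (at 1F)) adapted
    (λ { 0F → proj₂ (at 0F) ; 1F → proj₂ (at 1F) })
    (λ s → remaining _ s (from′ (rim _ s)))
    where
    from′ : ∀ x → c (encode x) ∈ colours x
    from′ x = subst (λ y → c (encode x) ∈ colours y) (decode-encode x) (from (encode x))
    at : ∀ p → ∃[ a ] c (encode (pole p)) ≡ tint p a
    at p = tint-of p (from′ (pole p))

-- Choosability is monotone in the list size, so the failure at 3 settles all smaller sizes.
¬choosable : ∀ j → j ℕ.< 4 → ¬ AdaptablyChoosable G j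
¬choosable j (s≤s j≤3) = ¬choosable₃ ∘ choosable-mono (ℕ.≤⇒≤′ j≤3)

¬conflictColourable : ∀ j → 1 ℕ.≤ j → j ℕ.< 4 → ¬ ConflictColourable G j
¬conflictColourable (suc j) _ j<4 = ¬choosable (suc j) j<4 ∘ conflict⇒choosable

-- Equal one-element lists are separated, yet no edge can be coloured properly from them.
¬separationChoosable₁ : ¬ SeparationChoosable G 1
¬separationChoosable₁ choosable
  with φ , proper , from ← choosable (record { list = λ _ → 0 ∷ [] ; size = λ _ → refl ; unique = λ _ → [] ∷ [] })
                                     (λ _ → s≤s z≤n) =
  proper (encode-adjacent (spoke {0F} {0F , 0F} {0F})) (trans (only (from _)) (sym (only (from _))))
  where
  only : ∀ {n} → n ∈ 0 ∷ [] → n ≡ 0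
  only (here e) = e

-- In the block indexed by the colours of the poles, the list of the end `0F` consists of exactly
-- those two colours. Each pole list can share only its own tint with it, whence separation.
¬separationChoosable₂ : ¬ SeparationChoosable G 2
¬separationChoosable₂ choosable =
  let φ , proper , from = choosable L separated in refute φ proper from
  where
  colours : Vertex → List ℕ
  colours (pole p)   = tint p 0F ∷ tint p 1F ∷ []
  colours (rim j 0F) = tints 0F j ∷ tints 1F j ∷ []
  -- Colours absent from all neighbouring lists keep the edges at this end separated.
  colours (rim j 1F) = 6 ∷ 7 ∷ []

  L : ListAssignment G 2
  L = record
    { list   = colours ∘ decode
    ; size   = size ∘ decode
    ; unique = unique ∘ decode
    }
    where
    size : ∀ x → length (colours x) ≡ 2
    size (pole _)   = refl
    size (rim _ 0F) = refl
    size (rim _ 1F) = refl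
    unique : ∀ x → Unique (colours x)
    unique (pole p)        = from-yes (all? λ p → unique? (colours (pole p))) p
    unique (rim (a , b) s) = from-yes (all? λ a → all? λ b → all? λ s → unique? (colours (rim (a , b) s))) a b s

  separated : ∀ {x y} → x ~ y → length (colours x ∩ colours y) ℕ.≤ 1
  separated (spoke {p} {a , b} {s}) = from-yes (all? λ p → all? λ a → all? λ b → all? λ s →
    length (colours (pole p) ∩ colours (rim (a , b) s)) ℕ.≤? 1) p a b s
  separated (spoke⁻ {p} {a , b} {s}) = from-yes (all? λ p → all? λ a → all? λ b → all? λ s →
    length (colours (rim (a , b) s) ∩ colours (pole p)) ℕ.≤? 1) p a b s
  separated (link {a , b} {s} {t} s≢t) = from-yes (all? λ a → all? λ b → all? λ s → all? λ t →
    ¬? (s ≟ t) →-dec (length (colours (rim (a , b) s) ∩ colours (rim (a , b) t)) ℕ.≤? 1)) a b s t s≢t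

  tint-of : ∀ {n} p → n ∈ colours (pole p) → ∃[ a ] n ≡ tint p a
  tint-of p (here e)         = 0F , e
  tint-of p (there (here e)) = 1F , e

  refute : ∀ φ → Proper G φ → From G L φ → ⊥
  refute φ proper from = clash (from′ (rim j 0F))
    where
    from′ : ∀ x → φ (encode x) ∈ colours x
    from′ x = subst (λ y → φ (encode x) ∈ colours y) (decode-encode x) (from (encode x))
    at : ∀ p → ∃[ a ] φ (encode (pole p)) ≡ tint p a
    at p = tint-of p (from′ (pole p))
    j : Block
    j = proj₁ (at 0F) , proj₁ (at 1F)
    clash : φ (encode (rim j 0F)) ∉ colours (rim j 0F)
    clash (here e)         = proper (encode-adjacent (spoke⁻ {0F} {j} {0F})) (trans e (sym (proj₂ (at 0F))))
    clash (there (here e)) = proper (encode-adjacent (spoke⁻ {1F} {j} {0F})) (trans e (sym (proj₂ (at 1F))))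

-- The four parameters

smallest₃ : ∀ {P : ℕ → Set} → P 3 → ¬ P 1 → ¬ P 2 → IsSmallest P 3
smallest₃ {P} P3 ¬P1 ¬P2 = record { positive = s≤s z≤n ; holds = P3 ; minimal = minimal }
  where
  minimal : ∀ j → 1 ℕ.≤ j → j ℕ.< 3 → ¬ P j
  minimal 1 _ _ = ¬P1
  minimal 2 _ _ = ¬P2
  minimal (suc (suc (suc _))) _ (s≤s (s≤s (s≤s ())))

theorem4p7 : Σ Graph λ G → Planar G
    × (χ-ad G ≐ 3)
    × (ch-sep G ≐ 3)
    × (ch-ad G ≐ 4)
    × (χ-conflict G ≐ 4)
theorem4p7 = G , planar
  , smallest₃ colourable₃ ¬colourable₁ ¬colourable₂
  , smallest₃ separationChoosable₃ ¬separationChoosable₁ ¬separationChoosable₂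
  , record { positive = s≤s z≤n
           ; holds    = conflict⇒choosable conflictColourable₄
           ; minimal  = λ j _ → ¬choosable j }
  , record { positive = s≤s z≤n
           ; holds    = conflictColourable₄
           ; minimal  = ¬conflictColourable }
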